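{- For every $n\ge 1$, the number of connected components of the poset $(\mathcal{M}_n, \leq_{\mathcal{M}})$ is the Fibonacci number $F_{n+1}$, where $F_1=1$, $F_2=1$ and $F_{m+1}=F_m+F_{m-1}$ for $m\ge 2$.
   Context: A Motzkin path is a non-empty lattice path in $\mathbb{Z}^2$ starting at $(0,0)$, ending on the diagonal $y=x$, staying weakly above the diagonal, with steps $N=(0,1)$, $E=(1,0)$, $D=(1,1)$. The size of a path is its number of steps, and $\mathcal{M}_n$ is the set of Motzkin paths of size $n$. Order: a valley of a path $P$ is a lattice point $v$ on $P$ preceded by an $E$ step and followed by an $N$ or $D$ step. Given a valley $v$ of a Motzkin path $P$, let $w$ be the next lattice point on $P$ after $v$ with the same horizontal distance to the diagonal as $v$ (the horizontal distance of $(a,b)$ is $b-a$). Exchanging the sub-path of $P$ between $v$ and $w$ with the $E$ step just before $v$ gives a Motzkin path $Q$; one says $Q$ covers $P$. The order $\leq_{\mathcal{M}}$ on $\mathcal{M}_n$ is the reflexive transitive closure of this covering relation. Connected components of a poset are those of its Hasse diagram. -}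

module Defs where

open import Data.Integer.Base using (ℤ; _⊖_)
open import Data.List.Base using (List; []; _∷_; _++_; length; foldl)
open import Data.List.Relation.Unary.All using (All)
open import Data.Nat.Base using (ℕ; suc; _+_; _≤_; _<_)
open import Data.Nat.Properties
  using (≤-refl; ≤-reflexive; ≤-trans; <-irrefl; n≤1+n; +-mono-≤; +-mono-<-≤; +-mono-≤-<)
open import Data.Product.Base using (_×_; _,_; proj₁; proj₂)
open import Data.Sum.Base using (_⊎_; inj₁; inj₂)
open import Level using (Level; _⊔_)
open import Relation.Binary.Bundles using (Setoid)
open import Relation.Binary.Core using (Rel)
open import Relation.Binary.Structures using (IsPartialOrder)
import Relation.Binary.Construct.Closure.Equivalence as EqClosure
open import Relation.Binary.Construct.Closure.ReflexiveTransitive using (Star; ε; _◅_; _◅◅_)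
import Relation.Binary.Construct.Closure.ReflexiveTransitive.Properties as Star
import Relation.Binary.Construct.NonStrictToStrict as ToStrict
open import Relation.Binary.PropositionalEquality using (_≡_; _≢_; refl; sym; cong; subst₂)
open import Relation.Nullary.Negation using (¬_; contradiction)

private
  variable
    a ℓ : Level

module _ {A : Set a} {_≼_ : Rel A ℓ} (isPO : IsPartialOrder _≡_ _≼_) where

  private
    _≺_ : Rel A (a ⊔ ℓ)
    _≺_ = ToStrict._<_ _≡_ _≼_

  Hasse : Rel A (a ⊔ ℓ)
  Hasse x y = x ≺ y × (∀ z → x ≺ z → ¬ (z ≺ y))

  -- Two elements are equal in this setoid when they are joined by a path of
  -- undirected Hasse edges, so its elements up to _≈_ are the components.
  Components : Setoid a (a ⊔ ℓ)
  Components = EqClosure.setoid Hasse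

data Step : Set where
  N E D : Step

Point : Set
Point = ℕ × ℕ

origin : Point
origin = 0 , 0

move : Point → Step → Point
move (x , y) N = x , suc y
move (x , y) E = suc x , y
move (x , y) D = suc x , suc y

endpoint : Point → List Step → Point
endpoint = foldl move

points : Point → List Step → List Point
points p []      = p ∷ []
points p (s ∷ w) = p ∷ points (move p s) w

hdist : Point → ℤ
hdist (x , y) = y ⊖ x

record IsMotzkin (w : List Step) : Set where
  field
    nonEmpty       : 0 < length w
    aboveDiagonal  : All (λ p → proj₁ p ≤ proj₂ p) (points origin w)
    endsOnDiagonal : proj₁ (endpoint origin w) ≡ proj₂ (endpoint origin w)

record Motzkin (n : ℕ) : Set where
  field
    steps     : List Step
    size      : length steps ≡ n
    isMotzkin : IsMotzkin steps

open Motzkin public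

-- P ⋖ Q: the path P has the form  before · E · (s · sub) · after,  where
-- v is the point between E and s.  As s is N or D, v is a valley; the point w
-- is the one between sub and after.  That these moves are covers of the order
-- they generate is not built in: Hasse is computed from _≤ᴹ_ itself.
record _⋖_ {n : ℕ} (P Q : Motzkin n) : Set where
  field
    before sub after : List Step
    s                : Step
    splitP           : steps P ≡ before ++ E ∷ (s ∷ sub) ++ after

  v : Point
  v = endpoint origin (before ++ E ∷ [])

  field
    valley           : s ≡ N ⊎ s ≡ D
    sameDistance     : hdist (endpoint v (s ∷ sub)) ≡ hdist v
    noEarlier        : ∀ t u → sub ≡ t ++ u → u ≢ [] →
                       hdist (endpoint v (s ∷ t)) ≢ hdist v
    splitQ           : steps Q ≡ before ++ (s ∷ sub) ++ E ∷ after

infix 4 _⋖_ _≤ᴹ_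

_≤ᴹ_ : {n : ℕ} → Rel (Motzkin n) _
_≤ᴹ_ = Star _⋖_

-- _≤ᴹ_ is a partial order: rank counts the pairs consisting of an N or D
-- step and a later E step, and strictly increases along _⋖_.
#E : List Step → ℕ
#E []      = 0
#E (N ∷ w) = #E w
#E (E ∷ w) = suc (#E w)
#E (D ∷ w) = #E w

rank : List Step → ℕ
rank []      = 0
rank (N ∷ w) = #E w + rank w
rank (E ∷ w) = rank w
rank (D ∷ w) = #E w + rank w

#E-insert : ∀ x r → #E (x ++ E ∷ r) ≡ suc (#E (x ++ r))
#E-insert []      r = refl
#E-insert (N ∷ x) r = #E-insert x r
#E-insert (E ∷ x) r = cong suc (#E-insert x r)
#E-insert (D ∷ x) r = #E-insert x r

#E-++ˡ : ∀ u {w w′} → #E w ≡ #E w′ → #E (u ++ w) ≡ #E (u ++ w′)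
#E-++ˡ []      eq = eq
#E-++ˡ (N ∷ u) eq = #E-++ˡ u eq
#E-++ˡ (E ∷ u) eq = cong suc (#E-++ˡ u eq)
#E-++ˡ (D ∷ u) eq = #E-++ˡ u eq

rank-++ˡ : ∀ u {w w′} → #E w ≡ #E w′ → rank w < rank w′ → rank (u ++ w) < rank (u ++ w′)
rank-++ˡ []      eq lt = lt
rank-++ˡ (N ∷ u) eq lt = +-mono-≤-< (≤-reflexive (#E-++ˡ u eq)) (rank-++ˡ u eq lt)
rank-++ˡ (E ∷ u) eq lt = rank-++ˡ u eq lt
rank-++ˡ (D ∷ u) eq lt = +-mono-≤-< (≤-reflexive (#E-++ˡ u eq)) (rank-++ˡ u eq lt)

rank-insert : ∀ x r → rank (x ++ r) ≤ rank (x ++ E ∷ r)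
rank-insert []      r = ≤-refl
rank-insert (N ∷ x) r rewrite #E-insert x r = +-mono-≤ (n≤1+n _) (rank-insert x r)
rank-insert (E ∷ x) r = rank-insert x r
rank-insert (D ∷ x) r rewrite #E-insert x r = +-mono-≤ (n≤1+n _) (rank-insert x r)

rank-swap : ∀ {s} x r → s ≡ N ⊎ s ≡ D → rank (E ∷ (s ∷ x) ++ r) < rank ((s ∷ x) ++ E ∷ r)
rank-swap x r (inj₁ refl) rewrite #E-insert x r = +-mono-<-≤ ≤-refl (rank-insert x r)
rank-swap x r (inj₂ refl) rewrite #E-insert x r = +-mono-<-≤ ≤-refl (rank-insert x r)

module _ {n : ℕ} where

  ⋖⇒rank< : {P Q : Motzkin n} → P ⋖ Q → rank (steps P) < rank (steps Q)
  ⋖⇒rank< P⋖Q = subst₂ (λ p q → rank p < rank q) (sym splitP) (sym splitQ)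
    (rank-++ˡ before (sym (#E-insert (s ∷ sub) after)) (rank-swap sub after valley))
    where open _⋖_ P⋖Q

  ≤ᴹ⇒rank≤ : {P Q : Motzkin n} → P ≤ᴹ Q → rank (steps P) ≤ rank (steps Q)
  ≤ᴹ⇒rank≤ ε        = ≤-refl
  ≤ᴹ⇒rank≤ (c ◅ cs) = ≤-trans (n≤1+n _) (≤-trans (⋖⇒rank< c) (≤ᴹ⇒rank≤ cs))

  ≤ᴹ-antisym : {P Q : Motzkin n} → P ≤ᴹ Q → Q ≤ᴹ P → P ≡ Q
  ≤ᴹ-antisym ε        _  = refl
  ≤ᴹ-antisym (c ◅ cs) ds =
    contradiction (≤-trans (⋖⇒rank< c) (≤ᴹ⇒rank≤ (cs ◅◅ ds))) (<-irrefl refl)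

≤ᴹ-isPartialOrder : ∀ n → IsPartialOrder _≡_ (_≤ᴹ_ {n})
≤ᴹ-isPartialOrder n = record
  { isPreorder = Star.isPreorder _⋖_
  ; antisym    = ≤ᴹ-antisym
  }

-- The convention F 0 = 0 extends F 1 = F 2 = 1.
F : ℕ → ℕ
F 0             = 0
F 1             = 1
F (suc (suc m)) = F (suc m) + F m

{-# OPTIONS --safe #-}

-- Erasing the E steps of a path leaves a word in N and D which no cover
-- changes; giving N weight 2 and D weight 1, it has weight n, and there are
-- F (n + 1) words of that weight.  Conversely a path with a given erasure can be
-- reached from the one in which every N is followed at once by an E, by moving
-- single E steps to the right across a D or across a peak NE.  Such a move
-- raises the rank by exactly 1, hence is an edge of the Hasse diagram.
module Submission where

open import Defs
open import Data.Fin.Base using (Fin; zero; _↑ˡ_; _↑ʳ_; splitAt)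
open import Data.Fin.Properties using (splitAt-↑ˡ; splitAt-↑ʳ; splitAt⁻¹-↑ˡ; splitAt⁻¹-↑ʳ)
open import Data.Integer.Properties using ([1+m]⊖[1+n]≡m⊖n; ⊖-monoˡ-<; <-irrefl)
open import Data.List.Base using (List; []; _∷_; _++_; length; concatMap; replicate)
open import Data.List.Properties using (concatMap-++; ∷-injectiveʳ)
open import Data.List.Relation.Unary.All using (All; []; _∷_) renaming (irrelevant to All-irrelevant)
open import Data.Nat.Base using (ℕ; zero; suc; _+_; _≤_; _<_; _≥_; s≤s⁻¹)
open import Data.Nat.Properties as ℕ using (+-suc; m≤n+m; ≤-irrelevant; ≡-irrelevant)
open import Data.Product.Base using (∃; _×_; _,_; proj₁; proj₂)
open import Data.Sum.Base using (_⊎_; inj₁; inj₂)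
open import Function.Bundles using (Bijection)
open import Relation.Binary.Construct.Closure.Equivalence as EqClosure using (EqClosure)
open import Relation.Binary.Construct.Closure.ReflexiveTransitive as Star using (Star; ε; _◅_; _◅◅_)
open import Relation.Binary.PropositionalEquality
  using (_≡_; _≢_; refl; sym; trans; cong; cong₂; subst; setoid; isEquivalence; module ≡-Reasoning)
open import Relation.Nullary.Negation using (contradiction)

private
  variable
    h n : ℕ
    w w′ : List Step

-- Paths measured by their distance to the diagonal

data Path : ℕ → List Step → Set where
  []  : Path 0 []
  N∷_ : Path (suc h) w → Path h (N ∷ w)
  E∷_ : Path h w → Path (suc h) (E ∷ w)
  D∷_ : Path h w → Path h (D ∷ w)

IsAbove : Point → Set
IsAbove p = proj₁ p ≤ proj₂ p

path : ∀ w {h x y} → y ≡ h + x → All IsAbove (points (x , y) w) →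
       proj₁ (endpoint (x , y) w) ≡ proj₂ (endpoint (x , y) w) → Path h w
path [] {h} y≡h+x _ x≡y with refl ← ℕ.+-cancelʳ-≡ _ h 0 (trans (sym y≡h+x) (sym x≡y)) = []
path (N ∷ w) y≡h+x (_ ∷ above) end = N∷ path w (cong suc y≡h+x) above end
path (D ∷ w) {h} {x} y≡h+x (_ ∷ above) end =
  D∷ path w (trans (cong suc y≡h+x) (sym (+-suc h x))) above end
-- The tail is split only so that `points` reduces and exhibits the next point, which lies below the
-- diagonal.
path (E ∷ []) {zero} {x} refl (_ ∷ (x<x ∷ _)) _ = contradiction x<x (ℕ.<-irrefl refl)
path (E ∷ _ ∷ _) {zero} refl (_ ∷ (x<x ∷ _)) _ = contradiction x<x (ℕ.<-irrefl refl)
path (E ∷ w) {suc h} {x} y≡h+x (_ ∷ above) end =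
  E∷ path w (trans y≡h+x (sym (+-suc h x))) above end

Path⇒above : ∀ {x y} → Path h w → y ≡ h + x → All IsAbove (points (x , y) w)
Path⇒above [] refl = ℕ.≤-refl ∷ []
Path⇒above {h} {x = x} (N∷ p) refl = m≤n+m x h ∷ Path⇒above p refl
Path⇒above {suc h} {x = x} (E∷ p) refl = m≤n+m x (suc h) ∷ Path⇒above p (sym (+-suc h x))
Path⇒above {h} {x = x} (D∷ p) refl = m≤n+m x h ∷ Path⇒above p (sym (+-suc h x))

Path⇒onDiagonal : ∀ {x y} → Path h w → y ≡ h + x →
                  proj₁ (endpoint (x , y) w) ≡ proj₂ (endpoint (x , y) w)
Path⇒onDiagonal [] refl = refl
Path⇒onDiagonal (N∷ p) refl = Path⇒onDiagonal p refl
Path⇒onDiagonal {suc h} {x = x} (E∷ p) refl = Path⇒onDiagonal p (sym (+-suc h x))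
Path⇒onDiagonal {h} {x = x} (D∷ p) refl = Path⇒onDiagonal p (sym (+-suc h x))

Motzkin⇒Path : (P : Motzkin n) → Path 0 (steps P)
Motzkin⇒Path P = path (steps P) refl aboveDiagonal endsOnDiagonal
  where open IsMotzkin (isMotzkin P)

Path⇒Motzkin : n ≥ 1 → length w ≡ n → Path 0 w → Motzkin n
Path⇒Motzkin {w = w} n≥1 ∣w∣≡n p = record
  { steps     = w
  ; size      = ∣w∣≡n
  ; isMotzkin = record
    { nonEmpty       = subst (0 <_) (sym ∣w∣≡n) n≥1
    ; aboveDiagonal  = Path⇒above p refl
    ; endsOnDiagonal = Path⇒onDiagonal p refl
    }
  }

-- Every field other than `steps` is a proposition, being built from `≡` and `≤` on naturals.
steps-injective : {P Q : Motzkin n} → steps P ≡ steps Q → P ≡ Q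
steps-injective {P = record { size = s ; isMotzkin = m }}
                {Q = record { size = s′ ; isMotzkin = m′ }} refl
  with refl ← ≡-irrelevant s s′
     | refl ← ≤-irrelevant (IsMotzkin.nonEmpty m) (IsMotzkin.nonEmpty m′)
     | refl ← All-irrelevant ≤-irrelevant (IsMotzkin.aboveDiagonal m) (IsMotzkin.aboveDiagonal m′)
     | refl ← ≡-irrelevant (IsMotzkin.endsOnDiagonal m) (IsMotzkin.endsOnDiagonal m′)
     = refl

-- The least path of each component

-- NE and D are the blocks over which a single move carries an E.
block : Step → List Step
block N = N ∷ E ∷ []
block E = []
block D = D ∷ []

least : List Step → List Step
least = concatMap block

data _⟶_ : List Step → List Step → Set where
  past : ∀ u s w → s ≡ N ⊎ s ≡ D → (u ++ E ∷ block s ++ w) ⟶ (u ++ block s ++ E ∷ w)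

∷-⟶ : ∀ s → w ⟶ w′ → (s ∷ w) ⟶ (s ∷ w′)
∷-⟶ s (past u s′ w s′≢E) = past (s ∷ u) s′ w s′≢E

∷-⟶* : ∀ s → Star _⟶_ w w′ → Star _⟶_ (s ∷ w) (s ∷ w′)
∷-⟶* s = Star.gmap (s ∷_) (∷-⟶ s)

-- The `E` nearest the block crosses first, so each of the others meets the block intact.
replicate-past : ∀ h s w → s ≡ N ⊎ s ≡ D →
                 Star _⟶_ (replicate h E ++ block s ++ w) (block s ++ replicate h E ++ w)
replicate-past zero    s w s≢E = ε
replicate-past (suc h) s w s≢E =
  ∷-⟶* E (replicate-past h s w s≢E) ◅◅ past [] s (replicate h E ++ w) s≢E ◅ ε

-- A path from height `h` has `h` more `E` than `N`; these surplus steps form the prefix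
-- `replicate h E`. At an `N` they cross the block `N E`, whose own `E` then joins them for height
-- `suc h`.
least-⟶* : Path h w → Star _⟶_ (replicate h E ++ least w) w
least-⟶* [] = ε
least-⟶* {h} (N∷_ {w = w} p) = replicate-past h N (least w) (inj₁ refl) ◅◅ ∷-⟶* N (least-⟶* p)
least-⟶* (E∷ p) = ∷-⟶* E (least-⟶* p)
least-⟶* {h} (D∷_ {w = w} p) = replicate-past h D (least w) (inj₂ refl) ◅◅ ∷-⟶* D (least-⟶* p)

-- A block fits at any height and ends at the height where it starts, so an `E` allowed after it is
-- allowed before it. This direction lets paths be built downwards from a given one.
Path-⟵ : w ⟶ w′ → Path h w′ → Path h w
Path-⟵ (past (N ∷ u) s w s≢E) (N∷ p) = N∷ Path-⟵ (past u s w s≢E) p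
Path-⟵ (past (E ∷ u) s w s≢E) (E∷ p) = E∷ Path-⟵ (past u s w s≢E) p
Path-⟵ (past (D ∷ u) s w s≢E) (D∷ p) = D∷ Path-⟵ (past u s w s≢E) p
Path-⟵ (past [] _ _ (inj₁ refl)) (N∷ (E∷ (E∷ p))) = E∷ (N∷ (E∷ p))
Path-⟵ (past [] _ _ (inj₂ refl)) (D∷ (E∷ p)) = E∷ (D∷ p)

length-⟶ : w ⟶ w′ → length w ≡ length w′
length-⟶ (past (_ ∷ u) s w s≢E) = cong suc (length-⟶ (past u s w s≢E))
length-⟶ (past [] _ _ (inj₁ refl)) = refl
length-⟶ (past [] _ _ (inj₂ refl)) = refl

#E-⟶ : w ⟶ w′ → #E w ≡ #E w′
#E-⟶ (past u _ _ (inj₁ refl)) = #E-++ˡ u refl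
#E-⟶ (past u _ _ (inj₂ refl)) = #E-++ˡ u refl

-- Only the `N` or `D` of the block gains a later `E`; passing the `E` of `N E` changes no count.
rank-⟶ : w ⟶ w′ → rank w′ ≡ suc (rank w)
rank-⟶ (past (N ∷ u) s w s≢E) =
  trans (cong₂ _+_ (sym (#E-⟶ w⟶w′)) (rank-⟶ w⟶w′)) (+-suc _ _)
  where w⟶w′ = past u s w s≢E
rank-⟶ (past (E ∷ u) s w s≢E) = rank-⟶ (past u s w s≢E)
rank-⟶ (past (D ∷ u) s w s≢E) =
  trans (cong₂ _+_ (sym (#E-⟶ w⟶w′)) (rank-⟶ w⟶w′)) (+-suc _ _)
  where w⟶w′ = past u s w s≢E
rank-⟶ (past [] _ _ (inj₁ refl)) = refl
rank-⟶ (past [] _ _ (inj₂ refl)) = refl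

-- Moves are edges of the Hasse diagram

hdist-D : ∀ p → hdist (move p D) ≡ hdist p
hdist-D (x , y) = [1+m]⊖[1+n]≡m⊖n y x

hdist-N≢ : ∀ p → hdist (move p N) ≢ hdist p
hdist-N≢ (x , y) eq = <-irrefl (sym eq) (⊖-monoˡ-< x (ℕ.n<1+n y))

⟶⇒⋖ : {P Q : Motzkin n} → steps P ⟶ steps Q → P ⋖ Q
⟶⇒⋖ {P = P} {Q} P⟶Q = cover refl refl P⟶Q
  where
  cover : steps P ≡ w → steps Q ≡ w′ → w ⟶ w′ → P ⋖ Q
  cover splitP splitQ (past u _ w (inj₁ refl)) = record
    { before = u ; sub = E ∷ [] ; after = w ; s = N
    ; splitP = splitP
    ; valley = inj₁ refl
    -- `N` followed by `E` leads to the same point as `D`, definitionally.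
    ; sameDistance = hdist-D (endpoint origin (u ++ E ∷ []))
    ; noEarlier = λ where
        -- The only proper prefix of `sub` is empty; its endpoint, reached by `N` alone, is one unit
        -- further from the diagonal than `v`.
        []      _       _    _    → hdist-N≢ (endpoint origin (u ++ E ∷ []))
        (_ ∷ []) []     _    u≢[] → contradiction refl u≢[]
    ; splitQ = splitQ
    }
  cover splitP splitQ (past u _ w (inj₂ refl)) = record
    { before = u ; sub = [] ; after = w ; s = D
    ; splitP = splitP
    ; valley = inj₂ refl
    ; sameDistance = hdist-D (endpoint origin (u ++ E ∷ []))
    ; noEarlier = λ { [] [] _ u≢[] → contradiction refl u≢[] }
    ; splitQ = splitQ
    }

≤ᴹ∧≢⇒rank< : {P Q : Motzkin n} → P ≤ᴹ Q → P ≢ Q → rank (steps P) < rank (steps Q)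
≤ᴹ∧≢⇒rank< ε        P≢P = contradiction refl P≢P
≤ᴹ∧≢⇒rank< (c ◅ cs) _   = ℕ.<-≤-trans (⋖⇒rank< c) (≤ᴹ⇒rank≤ cs)

Edge : Motzkin n → Motzkin n → Set
Edge {n} = Hasse (≤ᴹ-isPartialOrder n)

Connected : Motzkin n → Motzkin n → Set
Connected = EqClosure Edge

⟶⇒Edge : {P Q : Motzkin n} → steps P ⟶ steps Q → Edge P Q
⟶⇒Edge {n} {P} {Q} P⟶Q =
  (P⋖Q ◅ ε , λ P≡Q → ℕ.<-irrefl (cong (λ R → rank (steps R)) P≡Q) (⋖⇒rank< P⋖Q)) ,
  -- A path `Z` strictly between would have rank above `rank (steps P)` and below its successor.
  λ { Z (P≤Z , P≢Z) (Z≤Q , Z≢Q) → ℕ.<⇒≱ (≤ᴹ∧≢⇒rank< P≤Z P≢Z)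
        (s≤s⁻¹ (subst (rank (steps Z) <_) (rank-⟶ P⟶Q) (≤ᴹ∧≢⇒rank< Z≤Q Z≢Q))) }
  where
  P⋖Q : P ⋖ Q
  P⋖Q = ⟶⇒⋖ P⟶Q

-- Each word gets its `Path` and its length from the next one in the chain, so the paths are built
-- from the end `Q` backwards.
lift-⟶* : n ≥ 1 → Star _⟶_ w w′ → (Q : Motzkin n) → steps Q ≡ w′ →
          ∃ λ P → steps P ≡ w × Connected P Q
lift-⟶* n≥1 ε Q refl = Q , refl , ε
lift-⟶* n≥1 (w⟶v ◅ v⟶*w′) Q eq with lift-⟶* n≥1 v⟶*w′ Q eq
... | P , refl , P~Q =
  Path⇒Motzkin n≥1 (trans (length-⟶ w⟶v) (size P)) (Path-⟵ w⟶v (Motzkin⇒Path P)) ,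
  refl , EqClosure.transitive _ (EqClosure.return (⟶⇒Edge w⟶v)) P~Q

connected-to-least : n ≥ 1 → (Q : Motzkin n) → ∃ λ P → steps P ≡ least (steps Q) × Connected P Q
connected-to-least n≥1 Q = lift-⟶* n≥1 (least-⟶* (Motzkin⇒Path Q)) Q refl

least≡⇒Connected : n ≥ 1 → (P Q : Motzkin n) → least (steps P) ≡ least (steps Q) → Connected P Q
least≡⇒Connected n≥1 P Q eq with connected-to-least n≥1 P | connected-to-least n≥1 Q
... | P₀ , P₀≡ , P₀~P | Q₀ , Q₀≡ , Q₀~Q
  with refl ← steps-injective {P = P₀} {Q₀} (trans P₀≡ (trans eq (sym Q₀≡))) =
  EqClosure.transitive _ (EqClosure.symmetric _ P₀~P) Q₀~Q

-- `block E` is empty, so `least` forgets every `E`, and a cover only relocates one.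
least-⋖ : {P Q : Motzkin n} → P ⋖ Q → least (steps P) ≡ least (steps Q)
least-⋖ {P = P} {Q} P⋖Q = begin
  least (steps P)                                    ≡⟨ cong least splitP ⟩
  least (before ++ E ∷ (s ∷ sub) ++ after)           ≡⟨ concatMap-++ block before _ ⟩
  least before ++ least ((s ∷ sub) ++ after)         ≡⟨ cong (least before ++_) (concatMap-++ block (s ∷ sub) after) ⟩
  -- `least (E ∷ after)` computes to `least after`, so this line fits both neighbours.
  least before ++ least (s ∷ sub) ++ least (E ∷ after) ≡⟨ cong (least before ++_) (concatMap-++ block (s ∷ sub) (E ∷ after)) ⟨
  least before ++ least ((s ∷ sub) ++ E ∷ after)     ≡⟨ concatMap-++ block before _ ⟨
  least (before ++ (s ∷ sub) ++ E ∷ after)           ≡⟨ cong least splitQ ⟨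
  least (steps Q)                                    ∎
  where
  open ≡-Reasoning
  open _⋖_ P⋖Q

least-≤ᴹ : {P Q : Motzkin n} → P ≤ᴹ Q → least (steps P) ≡ least (steps Q)
least-≤ᴹ ε        = refl
least-≤ᴹ (c ◅ cs) = trans (least-⋖ c) (least-≤ᴹ cs)

least-Connected : {P Q : Motzkin n} → Connected P Q → least (steps P) ≡ least (steps Q)
least-Connected = EqClosure.gfold isEquivalence (λ P → least (steps P))
  λ { ((P≤Q , _) , _) → least-≤ᴹ P≤Q }

-- Counting the least paths

-- The two summands of the Fibonacci recurrence separate the words by their first block, `D` or
-- `N E`.
word : ∀ n → Fin (F (suc n)) → List Step
word zero    _ = []
word (suc n) i with splitAt (F (suc n)) i
word (suc n)       i | inj₁ j = D ∷ word n j
-- At size 1 this case cannot occur: the index would lie in `Fin (F 0)`, which is empty.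
word (suc (suc n)) i | inj₂ j = N ∷ E ∷ word n j

word-D : ∀ n (j : Fin (F (suc n))) → word (suc n) (j ↑ˡ F n) ≡ D ∷ word n j
word-D n j rewrite splitAt-↑ˡ (F (suc n)) j (F n) = refl

word-N : ∀ n (j : Fin (F (suc n))) → word (suc (suc n)) (F (suc (suc n)) ↑ʳ j) ≡ N ∷ E ∷ word n j
word-N n j rewrite splitAt-↑ʳ (F (suc (suc n))) (F (suc n)) j = refl

word-injective : ∀ n {i j} → word n i ≡ word n j → i ≡ j
word-injective zero {zero} {zero} _ = refl
word-injective (suc n) {i} {j} eq
  with splitAt (F (suc n)) i in eqᵢ | splitAt (F (suc n)) j in eqⱼ
word-injective (suc n) eq | inj₁ i′ | inj₁ j′
  with refl ← word-injective n (∷-injectiveʳ eq) =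
  trans (sym (splitAt⁻¹-↑ˡ eqᵢ)) (splitAt⁻¹-↑ˡ eqⱼ)
word-injective (suc (suc n)) eq | inj₂ i′ | inj₂ j′
  with refl ← word-injective n (∷-injectiveʳ (∷-injectiveʳ eq)) =
  trans (sym (splitAt⁻¹-↑ʳ eqᵢ)) (splitAt⁻¹-↑ʳ eqⱼ)
word-injective (suc (suc n)) () | inj₁ _ | inj₂ _
word-injective (suc (suc n)) () | inj₂ _ | inj₁ _

word-Path : ∀ n i → Path 0 (word n i)
word-Path zero _ = []
word-Path (suc n) i with splitAt (F (suc n)) i
word-Path (suc n)       i | inj₁ j = D∷ word-Path n j
word-Path (suc (suc n)) i | inj₂ j = N∷ (E∷ word-Path n j)

length-word : ∀ n i → length (word n i) ≡ n
length-word zero _ = refl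
length-word (suc n) i with splitAt (F (suc n)) i
length-word (suc n)       i | inj₁ j = cong suc (length-word n j)
length-word (suc (suc n)) i | inj₂ j = cong (λ m → suc (suc m)) (length-word n j)

least-word : ∀ n i → least (word n i) ≡ word n i
least-word zero _ = refl
least-word (suc n) i with splitAt (F (suc n)) i
least-word (suc n)       i | inj₁ j = cong (D ∷_) (least-word n j)
least-word (suc (suc n)) i | inj₂ j = cong (λ w → N ∷ E ∷ w) (least-word n j)

weight : List Step → ℕ
weight []      = 0
weight (N ∷ w) = suc (suc (weight w))
weight (E ∷ w) = weight w
weight (D ∷ w) = suc (weight w)

-- Weight 2 charges each `N` for an `E` as well. Descending from height `h` to 0 leaves exactly `h`
-- of the `E` steps uncharged.
length≡h+weight : Path h w → length w ≡ h + weight w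
length≡h+weight [] = refl
length≡h+weight {h} (N∷_ {w = w} p) = begin
  suc (length w)               ≡⟨ cong suc (length≡h+weight p) ⟩
  suc (suc (h + weight w))     ≡⟨ cong suc (+-suc h (weight w)) ⟨
  suc (h + suc (weight w))     ≡⟨ +-suc h (suc (weight w)) ⟨
  h + suc (suc (weight w))     ∎
  where open ≡-Reasoning
length≡h+weight (E∷ p) = cong suc (length≡h+weight p)
length≡h+weight {h} (D∷_ {w = w} p) = trans (cong suc (length≡h+weight p)) (sym (+-suc h (weight w)))

-- Indexing by `weight w` rather than by size lets the induction run through suffixes, which need
-- not be Motzkin paths.
least-is-word : ∀ w → ∃ λ i → word (weight w) i ≡ least w
least-is-word [] = zero , refl
least-is-word (E ∷ w) = least-is-word w
least-is-word (D ∷ w) with least-is-word w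
... | i , eq = i ↑ˡ F (weight w) , trans (word-D (weight w) i) (cong (D ∷_) eq)
least-is-word (N ∷ w) with least-is-word w
... | i , eq = F (suc (suc (weight w))) ↑ʳ i , trans (word-N (weight w) i) (cong (λ v → N ∷ E ∷ v) eq)

least-index : (P : Motzkin n) → ∃ λ i → word n i ≡ least (steps P)
-- At height 0 the weight is the length.
least-index P = subst (λ m → ∃ λ i → word m i ≡ least (steps P))
  (trans (sym (length≡h+weight (Motzkin⇒Path P))) (size P)) (least-is-word (steps P))

proposition4p1 : ∀ (n : ℕ) → n ≥ 1 →
    Bijection (Components (≤ᴹ-isPartialOrder n)) (setoid (Fin (F (suc n))))
proposition4p1 n n≥1 = record
  { to        = index
  ; cong      = index-cong
  ; bijective =
      (λ {P} {Q} eq → least≡⇒Connected n≥1 P Q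
        (trans (sym (word-index P)) (trans (cong (word n) eq) (word-index Q)))) ,
      -- The word numbered `i` is its own `least`, so the path on it has index `i`.
      λ i → wordPath i , λ P~wordPath → trans (index-cong P~wordPath)
        (word-injective n (trans (word-index (wordPath i)) (least-word n i)))
  }
  where
  index : Motzkin n → Fin (F (suc n))
  index P = proj₁ (least-index P)

  word-index : ∀ P → word n (index P) ≡ least (steps P)
  word-index P = proj₂ (least-index P)

  index-cong : ∀ {P Q} → Connected P Q → index P ≡ index Q
  index-cong {P} {Q} P~Q = word-injective n
    (trans (word-index P) (trans (least-Connected P~Q) (sym (word-index Q))))

  wordPath : Fin (F (suc n)) → Motzkin n
  wordPath i = Path⇒Motzkin n≥1 (length-word n i) (word-Path n i)
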